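{- Let $X$ be a nonempty set and let $\sqcup\!\sqcup$ denote the shuffle product on the $\mathbb{Q}$-vector space spanned by words in $X$. Let $k,\ell\ge 1$, let $y_1,\ldots,y_k,z_1,\ldots,z_\ell\in X$, and let $m_1,\ldots,m_k,n_1,\ldots,n_\ell\in\mathbb{Z}_{\ge 1}$. Then $$ \begin{aligned} &(y_1^{m_1}\cdots y_k^{m_k})\sqcup\!\sqcup(z_1^{n_1}\cdots z_\ell^{n_\ell})\\ &=\sum_{1\le j\le \ell}\ \sum_{\substack{1\le p\le n_j\\ p+q=n_j}}\big(y_1^{m_1-1}\sqcup\!\sqcup(z_1^{n_1}\cdots z_{j-1}^{n_{j-1}}z_j^{p})\big)\,y_1\,\big((y_2^{m_2}\cdots y_k^{m_k})\sqcup\!\sqcup(z_j^{q}z_{j+1}^{n_{j+1}}\cdots z_\ell^{n_\ell})\big)\\ &\quad+y_1^{m_1}\big((y_2^{m_2}\cdots y_k^{m_k})\sqcup\!\sqcup(z_1^{n_1}\cdots z_\ell^{n_\ell})\big), \end{aligned} $$ where juxtaposition denotes concatenation of words, extended bilinearly.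
   Context: For a nonempty set $X$, consider the $\mathbb{Q}$-vector space with basis the words in $X$ (including the empty word, which is the unit for both concatenation and shuffle product). Here $x^p$ means the word $x\cdots x$ with $p$ letters, which is the empty word for $p=0$; empty products of letters (such as $y_2^{m_2}\cdots y_k^{m_k}$ when $k=1$) are the empty word. For words $a=a_1\cdots a_m$ and $b=b_1\cdots b_n$ with $m,n\ge 1$ and $a_i,b_j\in X$, the shuffle product is $$a\sqcup\!\sqcup b=\sum_{(\varphi,\psi)\in J_{m,n}}c_1\cdots c_{m+n},$$ where $J_{m,n}$ is the set of pairs of order-preserving injective maps $\varphi:\{1,\ldots,m\}\to\{1,\ldots,m+n\}$, $\psi:\{1,\ldots,n\}\to\{1,\ldots,m+n\}$ with $\operatorname{im}\varphi\cup\operatorname{im}\psi=\{1,\ldots,m+n\}$, and $c_i=a_r$ if $i=\varphi(r)$, $c_i=b_r$ if $i=\psi(r)$. It is extended bilinearly. -}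

module Defs where

open import Level using (Level)
open import Data.Nat.Base using (ℕ; suc; _+_; _∸_; _^_)
open import Data.Fin.Base as Fin using (Fin; toℕ; finToFun)
open import Data.Fin.Properties using (any?; all?; _≟_; _≤?_)
open import Data.List.Base
  using (List; []; _∷_; _++_; map; concat; concatMap; mapMaybe; replicate;
         tabulate; allFin; cartesianProduct; take; drop; length; lookup)
open import Data.Maybe.Base as Maybe using ()
open import Data.Product.Base using (_×_; _,_; ∃-syntax)
open import Data.Rational.Base as ℚ using (ℚ; 0ℚ; 1ℚ)
open import Data.Sum.Base using (_⊎_; inj₁; inj₂)
open import Function.Base using (_∘_)
open import Function.Definitions using (Injective)
open import Relation.Binary.Core using (_Preserves_⟶_)
open import Relation.Binary.PropositionalEquality using (_≡_)
open import Relation.Nullary.Decidable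
  using (Dec; dec⇒maybe; map′; _×-dec_; _⊎-dec_; _→-dec_)

private
  variable
    a b : Level
    A : Set a
    X : Set b

Word : Set b → Set b
Word X = List X

-- The ℚ-vector space with basis the words in X: the list
-- (c₁ , w₁) ∷ … ∷ (cₛ , wₛ) ∷ [] stands for c₁ w₁ + … + cₛ wₛ, and
-- equality of vectors is _≈_ (not _≡_).  No decidable equality on X is
-- needed, unlike for a representation by coefficient functions.

ℚ⟨_⟩ : Set b → Set b
ℚ⟨ X ⟩ = List (ℚ × Word X)

infix 4 _≈_

data _≈_ {X : Set b} : ℚ⟨ X ⟩ → ℚ⟨ X ⟩ → Set b where
  ≈-refl  : ∀ {u} → u ≈ u
  ≈-sym   : ∀ {u v} → u ≈ v → v ≈ u
  ≈-trans : ∀ {u v t} → u ≈ v → v ≈ t → u ≈ t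
  ≈-cons  : ∀ s {u v} → u ≈ v → s ∷ u ≈ s ∷ v
  ≈-swap  : ∀ s t {u} → s ∷ t ∷ u ≈ t ∷ s ∷ u
  ≈-merge : ∀ c d w {u} → (c , w) ∷ (d , w) ∷ u ≈ (c ℚ.+ d , w) ∷ u
  ≈-zero  : ∀ w {u} → (0ℚ , w) ∷ u ≈ u

⟦_⟧ : Word X → ℚ⟨ X ⟩
⟦ w ⟧ = (1ℚ , w) ∷ []

infixl 6 _⊕_

_⊕_ : ℚ⟨ X ⟩ → ℚ⟨ X ⟩ → ℚ⟨ X ⟩
_⊕_ = _++_

infixr 8 _⊙_

_⊙_ : ℚ → ℚ⟨ X ⟩ → ℚ⟨ X ⟩
c ⊙ u = map (λ { (d , w) → c ℚ.* d , w }) u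

∑ : List A → (A → ℚ⟨ X ⟩) → ℚ⟨ X ⟩
∑ is f = concatMap f is

infix 5 ∑
syntax ∑ is (λ i → u) = ∑[ i ∈ is ] u

bilinear : (Word X → Word X → ℚ⟨ X ⟩) → ℚ⟨ X ⟩ → ℚ⟨ X ⟩ → ℚ⟨ X ⟩
bilinear f u v = ∑ u λ { (c , w) → ∑ v λ { (d , w′) → (c ℚ.* d) ⊙ f w w′ } }

infixl 7 _·_

_·_ : ℚ⟨ X ⟩ → ℚ⟨ X ⟩ → ℚ⟨ X ⟩
_·_ = bilinear (λ w w′ → ⟦ w ++ w′ ⟧)

record InJ (m n : ℕ) (φ : Fin m → Fin (m + n)) (ψ : Fin n → Fin (m + n)) : Set where
  constructor mkInJ
  field
    φ-mono : φ Preserves Fin._≤_ ⟶ Fin._≤_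
    φ-inj  : Injective _≡_ _≡_ φ
    ψ-mono : ψ Preserves Fin._≤_ ⟶ Fin._≤_
    ψ-inj  : Injective _≡_ _≡_ ψ
    cover  : ∀ i → (∃[ r ] φ r ≡ i) ⊎ (∃[ r ] ψ r ≡ i)

record J (m n : ℕ) : Set where
  constructor mkJ
  field
    φ   : Fin m → Fin (m + n)
    ψ   : Fin n → Fin (m + n)
    inJ : InJ m n φ ψ
  open InJ inJ public

mono? : ∀ {m n} (f : Fin m → Fin n) → Dec (f Preserves Fin._≤_ ⟶ Fin._≤_)
mono? f = map′ (λ h {i} {j} → h i j) (λ h i j → h {i} {j})
  (all? λ i → all? λ j → (i ≤? j) →-dec (f i ≤? f j))

inj? : ∀ {m n} (f : Fin m → Fin n) → Dec (Injective _≡_ _≡_ f)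
inj? f = map′ (λ h {i} {j} → h i j) (λ h i j → h {i} {j})
  (all? λ i → all? λ j → (f i ≟ f j) →-dec (i ≟ j))

inJ? : ∀ {m n} φ ψ → Dec (InJ m n φ ψ)
inJ? {m} {n} φ ψ = map′ to from
  (mono? φ ×-dec inj? φ ×-dec mono? ψ ×-dec inj? ψ ×-dec
   all? λ i → any? (λ r → φ r ≟ i) ⊎-dec any? (λ r → ψ r ≟ i))
  where
  Fields : Set
  Fields = φ Preserves Fin._≤_ ⟶ Fin._≤_ × Injective _≡_ _≡_ φ ×
           ψ Preserves Fin._≤_ ⟶ Fin._≤_ × Injective _≡_ _≡_ ψ ×
           (∀ i → (∃[ r ] φ r ≡ i) ⊎ (∃[ r ] ψ r ≡ i))

  to : Fields → InJ m n φ ψ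
  to (p , q , r , s , t) = mkInJ p q r s t

  from : InJ m n φ ψ → Fields
  from (mkInJ p q r s t) = p , q , r , s , t

-- Every function Fin m → Fin N is, pointwise, finToFun of exactly one
-- element of Fin (N ^ m), so each element of J m n is listed exactly once.

allMaps : ∀ m N → List (Fin m → Fin N)
allMaps m N = map finToFun (allFin (N ^ m))

allJ : ∀ m n → List (J m n)
allJ m n = mapMaybe
  (λ { (φ , ψ) → Maybe.map (mkJ φ ψ) (dec⇒maybe (inJ? φ ψ)) })
  (cartesianProduct (allMaps m (m + n)) (allMaps n (m + n)))

-- By counting, the images of φ and ψ are disjoint, so the case chosen by
-- cover is the only one possible.

shuffled : (u v : Word X) → J (length u) (length v) → Word X
shuffled u v σ = tabulate (letter ∘ J.cover σ)
  where
  letter : ∀ {i} → (∃[ r ] J.φ σ r ≡ i) ⊎ (∃[ r ] J.ψ σ r ≡ i) → _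
  letter (inj₁ (r , _)) = lookup u r
  letter (inj₂ (r , _)) = lookup v r

shuffleWords : Word X → Word X → ℚ⟨ X ⟩
shuffleWords []          v           = ⟦ v ⟧
shuffleWords u@(_ ∷ _)   []          = ⟦ u ⟧
shuffleWords u@(_ ∷ _)   v@(_ ∷ _)   =
  ∑[ σ ∈ allJ (length u) (length v) ] ⟦ shuffled u v σ ⟧

infixl 7 _⧢_

_⧢_ : ℚ⟨ X ⟩ → ℚ⟨ X ⟩ → ℚ⟨ X ⟩
_⧢_ = bilinear shuffleWords

infixr 9 _^ʷ_

_^ʷ_ : X → ℕ → Word X
x ^ʷ p = replicate p x

powers : ∀ {k} → (Fin k → X) → (Fin k → ℕ) → List (Word X)
powers x e = tabulate (λ i → x i ^ʷ e i)

powerWord : ∀ {k} → (Fin k → X) → (Fin k → ℕ) → Word X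
powerWord x e = concat (powers x e)

powerWord< : ∀ {k} → Fin k → (Fin k → X) → (Fin k → ℕ) → Word X
powerWord< j x e = concat (take (toℕ j) (powers x e))

powerWord> : ∀ {k} → Fin k → (Fin k → X) → (Fin k → ℕ) → Word X
powerWord> j x e = concat (drop (suc (toℕ j)) (powers x e))

[1⋯_] : ℕ → List ℕ
[1⋯ n ] = tabulate {n = n} (suc ∘ toℕ)

{-# OPTIONS --safe #-}

-- Cut each word of the shuffle at the last letter y₁ of the block y₁^m₁.  To
-- its left stands a word of y₁^(m₁-1) ⧢ v₁ and to its right a word of
-- (y₂^m₂ ⋯ yₖ^mₖ) ⧢ v₂, where v₁ v₂ is a factorisation of z₁^n₁ ⋯ zₗ^nₗ.  Each
-- nonempty v₁ is z₁^n₁ ⋯ zⱼ^p for exactly one j and 1 ≤ p ≤ nⱼ; the empty v₁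
-- gives the last summand.  All coefficients are 1, so the identity holds
-- between lists of words up to permutation.  This is an induction on
-- words by xu ⧢ yv = x (u ⧢ yv) + y (xu ⧢ v), a recursion that comes from a
-- bijection of J with lattice paths.

module Submission where

open import Defs
open import Data.Nat.Base using (ℕ; suc; _∸_; _≤_)
open import Data.Fin.Base using (Fin; zero; suc)
open import Data.List.Base using (_++_; []; _∷_; allFin)
open import Function.Base using (_∘_)

open import Level using (Level)
open import Data.Nat.Base as ℕ using (zero; _+_; _^_; z<s; s<s)
import Data.Nat.Properties as ℕ
open import Data.Fin.Base as Fin using (toℕ; punchOut; join; splitAt; finToFun; funToFin)
import Data.Fin.Properties as Fin
open import Data.List.Base
  using (List; [_]; map; mapMaybe; concatMap; tabulate; cartesianProductWith; length; lookup)
import Data.List.Properties as List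
open import Data.List.Membership.Propositional using (_∈_; lose)
open import Data.List.Membership.Propositional.Properties
  using (∈-map⁺; ∈-map⁻; ∈-++⁺ˡ; ∈-++⁺ʳ; ∈-allFin; ∈-cartesianProduct⁺)
open import Data.List.Membership.Propositional.Properties.WithK using (unique∧set⇒bag)
open import Data.List.Relation.Binary.BagAndSetEquality using (∼bag⇒↭)
open import Data.List.Relation.Binary.Permutation.Propositional as ↭
  using (_↭_; refl; prep; swap; ↭-refl; ↭-trans; ↭-reflexive; module PermutationReasoning)
import Data.List.Relation.Binary.Permutation.Propositional.Properties as ↭
open import Data.List.Relation.Unary.All using (All; []; _∷_)
open import Data.List.Relation.Unary.AllPairs as AllPairs using (AllPairs; []; _∷_)
import Data.List.Relation.Unary.AllPairs.Properties as AllPairs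
open import Data.List.Relation.Unary.Any as Any using (Any; here)
import Data.List.Relation.Unary.Any.Properties as Any
open import Data.List.Relation.Unary.Unique.Propositional using (Unique)
import Data.List.Relation.Unary.Unique.Propositional.Properties as Unique
import Data.List.Relation.Unary.Unique.Setoid.Properties as UniqueS
open import Data.Maybe.Base as Maybe using (Maybe; just; nothing)
import Data.Maybe.Relation.Unary.Any as MAny
open import Data.Product.Base using (_×_; _,_; ∃-syntax; proj₁; proj₂; map₁; map₂)
open import Data.Rational.Base as ℚ using (1ℚ)
open import Data.Sum.Base using (_⊎_; inj₁; inj₂; [_,_]′)
open import Function.Base using (id)
open import Function.Bundles using (mk⇔)
open import Function.Definitions using (Injective)
open import Relation.Binary.Core using (Rel; _Preserves_⟶_)
open import Relation.Binary.Definitions using (tri<; tri≈; tri>)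
open import Relation.Binary.PropositionalEquality
  using (_≡_; _≢_; _≗_; refl; sym; trans; cong; cong₂; subst; subst₂; _→-setoid_; module ≡-Reasoning)
open import Relation.Nullary using (¬_; yes; no; contradiction)
open import Relation.Nullary.Decidable using (dec⇒maybe)

private
  variable
    a : Level
    A B C X : Set a
    m n N : ℕ

-- Lattice paths and the positions of the letters along them.

-- A lattice path records a shuffle letter by letter; Path m n N is inhabited
-- only for N ≡ m + n, and the free index N avoids transports along +-suc.
data Path : ℕ → ℕ → ℕ → Set where
  done  : Path 0 0 0
  left  : Path m n N → Path (suc m) n (suc N)
  right : Path m n N → Path m (suc n) (suc N)

leftPos : Path m n N → Fin m → Fin N
leftPos (left c)  zero    = zero
leftPos (left c)  (suc r) = suc (leftPos c r)
leftPos (right c) r       = suc (leftPos c r)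

rightPos : Path m n N → Fin n → Fin N
rightPos (left c)  s       = suc (rightPos c s)
rightPos (right c) zero    = zero
rightPos (right c) (suc s) = suc (rightPos c s)

-- The letters are given by functions because `lookup (x ∷ u) ∘ suc` is `lookup u` by computation,
-- so following a path consumes the words letter by letter.
letterAt : Path m n N → (Fin m → X) → (Fin n → X) → Fin N → X
letterAt (left c)  f g zero    = f zero
letterAt (left c)  f g (suc i) = letterAt c (f ∘ suc) g i
letterAt (right c) f g zero    = g zero
letterAt (right c) f g (suc i) = letterAt c f (g ∘ suc) i

letterAt-leftPos : ∀ (c : Path m n N) (f : Fin m → X) g r → letterAt c f g (leftPos c r) ≡ f r
letterAt-leftPos (left c)  f g zero    = refl
letterAt-leftPos (left c)  f g (suc r) = letterAt-leftPos c (f ∘ suc) g r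
letterAt-leftPos (right c) f g r       = letterAt-leftPos c f (g ∘ suc) r

letterAt-rightPos : ∀ (c : Path m n N) (f : Fin m → X) g s → letterAt c f g (rightPos c s) ≡ g s
letterAt-rightPos (left c)  f g s       = letterAt-rightPos c (f ∘ suc) g s
letterAt-rightPos (right c) f g zero    = refl
letterAt-rightPos (right c) f g (suc s) = letterAt-rightPos c f (g ∘ suc) s

spell : Path m n N → (Fin m → X) → (Fin n → X) → Word X
spell c f g = tabulate (letterAt c f g)

record Traces (c : Path m n N) (φ : Fin m → Fin N) (ψ : Fin n → Fin N) : Set where
  constructor _,_
  field
    φ≗ : φ ≗ leftPos c
    ψ≗ : ψ ≗ rightPos c

-- The first step can be read off the positions: after `left` the first left letter sits at `zero`,
-- after `right` every left position is a successor.
positions-injective : (c d : Path m n N) → leftPos c ≗ leftPos d → rightPos c ≗ rightPos d → c ≡ d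
positions-injective done      done      l r = refl
positions-injective (left c)  (left d)  l r =
  cong left (positions-injective c d (Fin.suc-injective ∘ l ∘ suc) (Fin.suc-injective ∘ r))
positions-injective (left c)  (right d) l r with () ← l zero
positions-injective (right c) (left d)  l r with () ← l zero
positions-injective (right c) (right d) l r =
  cong right (positions-injective c d (Fin.suc-injective ∘ l) (Fin.suc-injective ∘ r ∘ suc))

leftPos-mono-< : (c : Path m n N) → leftPos c Preserves Fin._<_ ⟶ Fin._<_
leftPos-mono-< (left c)  {zero}  {suc s} r<s       = z<s
leftPos-mono-< (left c)  {suc r} {suc s} (s<s r<s) = s<s (leftPos-mono-< c r<s)
leftPos-mono-< (right c) r<s                       = s<s (leftPos-mono-< c r<s)

rightPos-mono-< : (c : Path m n N) → rightPos c Preserves Fin._<_ ⟶ Fin._<_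
rightPos-mono-< (left c)  r<s                       = s<s (rightPos-mono-< c r<s)
rightPos-mono-< (right c) {zero}  {suc s} r<s       = z<s
rightPos-mono-< (right c) {suc r} {suc s} (s<s r<s) = s<s (rightPos-mono-< c r<s)

positions-cover : (c : Path m n N) → ∀ i → (∃[ r ] leftPos c r ≡ i) ⊎ (∃[ s ] rightPos c s ≡ i)
positions-cover (left c)  zero    = inj₁ (zero , refl)
positions-cover (left c)  (suc i) with positions-cover c i
... | inj₁ (r , eq) = inj₁ (suc r , cong suc eq)
... | inj₂ (s , eq) = inj₂ (s , cong suc eq)
positions-cover (right c) zero    = inj₂ (zero , refl)
positions-cover (right c) (suc i) with positions-cover c i
... | inj₁ (r , eq) = inj₁ (r , cong suc eq)
... | inj₂ (s , eq) = inj₂ (suc s , cong suc eq)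

-- Pairs of maps in `J` and lattice paths.

mono-<⇒mono-≤ : (f : Fin m → Fin n) → f Preserves Fin._<_ ⟶ Fin._<_ → f Preserves Fin._≤_ ⟶ Fin._≤_
mono-<⇒mono-≤ f mono {i} {j} i≤j with Fin.<-cmp i j
... | tri< i<j _ _  = ℕ.<⇒≤ (mono i<j)
... | tri≈ _ refl _ = ℕ.≤-refl
... | tri> _ _ j<i  = contradiction j<i (ℕ.≤⇒≯ i≤j)

mono-<⇒injective : (f : Fin m → Fin n) → f Preserves Fin._<_ ⟶ Fin._<_ → Injective _≡_ _≡_ f
mono-<⇒injective f mono {i} {j} fi≡fj with Fin.<-cmp i j
... | tri< i<j _ _  = contradiction fi≡fj (Fin.<⇒≢ (mono i<j))
... | tri≈ _ i≡j _  = i≡j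
... | tri> _ _ j<i  = contradiction (sym fi≡fj) (Fin.<⇒≢ (mono j<i))

mono-≤∧injective⇒mono-< : (f : Fin m → Fin n) → f Preserves Fin._≤_ ⟶ Fin._≤_ →
                          Injective _≡_ _≡_ f → f Preserves Fin._<_ ⟶ Fin._<_
mono-≤∧injective⇒mono-< f mono inj i<j =
  Fin.≤∧≢⇒< (mono (ℕ.<⇒≤ i<j)) (Fin.<⇒≢ i<j ∘ inj)

mono-<-resp-≗ : {f g : Fin m → Fin n} → f ≗ g →
                g Preserves Fin._<_ ⟶ Fin._<_ → f Preserves Fin._<_ ⟶ Fin._<_
mono-<-resp-≗ f≗g mono {i} {j} i<j =
  subst₂ Fin._<_ (sym (f≗g i)) (sym (f≗g j)) (mono i<j)

traces⇒InJ : {c : Path m n (m + n)} {φ : Fin m → Fin (m + n)} {ψ : Fin n → Fin (m + n)} →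
             Traces c φ ψ → InJ m n φ ψ
traces⇒InJ {m} {n} {c} {φ} {ψ} (φ≗ , ψ≗) = mkInJ
  (mono-<⇒mono-≤ φ φ-<) (mono-<⇒injective φ φ-<)
  (mono-<⇒mono-≤ ψ ψ-<) (mono-<⇒injective ψ ψ-<)
  cover
  where
  φ-< : φ Preserves Fin._<_ ⟶ Fin._<_
  φ-< = mono-<-resp-≗ φ≗ (leftPos-mono-< c)

  ψ-< : ψ Preserves Fin._<_ ⟶ Fin._<_
  ψ-< = mono-<-resp-≗ ψ≗ (rightPos-mono-< c)

  cover : ∀ i → (∃[ r ] φ r ≡ i) ⊎ (∃[ s ] ψ s ≡ i)
  cover i with positions-cover c i
  ... | inj₁ (r , eq) = inj₁ (r , trans (φ≗ r) eq)
  ... | inj₂ (s , eq) = inj₂ (s , trans (ψ≗ s) eq)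

-- The form of `InJ` fit for induction: symmetric in the two maps, with `N` free so that position
-- `zero` can be removed, and with disjointness made explicit.
record Partition (φ : Fin m → Fin N) (ψ : Fin n → Fin N) : Set where
  field
    φ-<      : φ Preserves Fin._<_ ⟶ Fin._<_
    ψ-<      : ψ Preserves Fin._<_ ⟶ Fin._<_
    cover    : ∀ i → (∃[ r ] φ r ≡ i) ⊎ (∃[ s ] ψ s ≡ i)
    disjoint : ∀ r s → φ r ≢ ψ s

Partition-swap : {φ : Fin m → Fin N} {ψ : Fin n → Fin N} → Partition φ ψ → Partition ψ φ
Partition-swap p = record
  { φ-<      = ψ-<
  ; ψ-<      = φ-<
  ; cover    = [ inj₂ , inj₁ ]′ ∘ cover
  ; disjoint = λ r s → disjoint s r ∘ sym
  }
  where open Partition p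

lower : (f : Fin m → Fin (suc N)) → (∀ r → f r ≢ zero) → ∃[ f′ ] f ≗ suc ∘ f′
lower f f≢0 = (λ r → proj₁ (pred (f r) (f≢0 r))) , (λ r → proj₂ (pred (f r) (f≢0 r)))
  where
  pred : (i : Fin (suc N)) → i ≢ zero → ∃[ j ] i ≡ suc j
  pred zero    i≢0 = contradiction refl i≢0
  pred (suc j) _   = j , refl

mono-<-unsuc : {f : Fin m → Fin (suc N)} {f′ : Fin m → Fin N} → f ≗ suc ∘ f′ →
               f Preserves Fin._<_ ⟶ Fin._<_ → f′ Preserves Fin._<_ ⟶ Fin._<_
mono-<-unsuc f≗ mono {i} {j} i<j = ℕ.s<s⁻¹ (subst₂ Fin._<_ (f≗ i) (f≗ j) (mono i<j))

-- Once `φ zero` occupies position `zero`, strict monotonicity keeps the rest of `φ` off it and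
-- disjointness keeps `ψ` off it, so all remaining values can be lowered by one.
peel : {φ : Fin (suc m) → Fin (suc N)} {ψ : Fin n → Fin (suc N)} → Partition φ ψ → φ zero ≡ zero →
       ∃[ φ′ ] ∃[ ψ′ ] (φ ∘ suc ≗ suc ∘ φ′) × (ψ ≗ suc ∘ ψ′) × Partition φ′ ψ′
peel {m} {N} {n} {φ} {ψ} p φ0≡0 = φ′ , ψ′ , φ≗ , ψ≗ , record
  { φ-<      = mono-<-unsuc φ≗ (φ-< ∘ s<s)
  ; ψ-<      = mono-<-unsuc ψ≗ ψ-<
  ; cover    = cover′
  ; disjoint = λ r s eq → disjoint (suc r) s (trans (φ≗ r) (trans (cong suc eq) (sym (ψ≗ s))))
  }
  where
  open Partition p

  φ∘suc≢0 : ∀ r → φ (suc r) ≢ zero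
  φ∘suc≢0 r eq = Fin.<⇒≢ (φ-< {zero} {suc r} z<s) (trans φ0≡0 (sym eq))

  ψ≢0 : ∀ s → ψ s ≢ zero
  ψ≢0 s eq = disjoint zero s (trans φ0≡0 (sym eq))

  φ′ = proj₁ (lower (φ ∘ suc) φ∘suc≢0)
  φ≗ = proj₂ (lower (φ ∘ suc) φ∘suc≢0)
  ψ′ = proj₁ (lower ψ ψ≢0)
  ψ≗ = proj₂ (lower ψ ψ≢0)

  cover′ : ∀ i → (∃[ r ] φ′ r ≡ i) ⊎ (∃[ s ] ψ′ s ≡ i)
  cover′ i with cover (suc i)
  ... | inj₁ (zero  , eq) with () ← trans (sym φ0≡0) eq
  ... | inj₁ (suc r , eq) = inj₁ (r , Fin.suc-injective (trans (sym (φ≗ r)) eq))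
  ... | inj₂ (s     , eq) = inj₂ (s , Fin.suc-injective (trans (sym (ψ≗ s)) eq))

first≡zero : (f : Fin (suc m) → Fin (suc N)) → f Preserves Fin._<_ ⟶ Fin._<_ →
             ∀ r → f r ≡ zero → f zero ≡ zero
first≡zero f mono zero    eq = eq
first≡zero f mono (suc r) eq with () ← subst (f zero Fin.<_) eq (mono {zero} {suc r} z<s)

-- Induction on the number of positions: the side that covers position `zero` dictates the first
-- step of the path.
partition⇒path : (φ : Fin m → Fin N) (ψ : Fin n → Fin N) → Partition φ ψ → ∃[ c ] Traces c φ ψ
partition⇒path {zero}  {zero}  {zero}  φ ψ p = done , ((λ ()) , (λ ()))
partition⇒path {suc m} {zero}  {n}     φ ψ p with () ← φ zero
partition⇒path {zero}  {zero}  {suc n} φ ψ p with () ← ψ zero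
partition⇒path {m}     {suc N} {n}     φ ψ p with Partition.cover p zero
partition⇒path {suc m} {suc N} {n} φ ψ p | inj₁ (r , eq)
  with φ0≡0 ← first≡zero φ (Partition.φ-< p) r eq
  with φ′ , ψ′ , φ≗ , ψ≗ , p′ ← peel p φ0≡0
  with c , (φ′≗ , ψ′≗) ← partition⇒path φ′ ψ′ p′
  = left c , ((λ { zero → φ0≡0 ; (suc r) → trans (φ≗ r) (cong suc (φ′≗ r)) })
             , λ s → trans (ψ≗ s) (cong suc (ψ′≗ s)))
partition⇒path {m} {suc N} {suc n} φ ψ p | inj₂ (s , eq)
  with ψ0≡0 ← first≡zero ψ (Partition.ψ-< p) s eq
  -- `peel` removes the first value of the first map only, so the roles are exchanged before it and
  -- restored after it.
  with ψ′ , φ′ , ψ≗ , φ≗ , p′ ← peel (Partition-swap p) ψ0≡0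
  with c , (φ′≗ , ψ′≗) ← partition⇒path φ′ ψ′ (Partition-swap p′)
  = right c , ((λ r → trans (φ≗ r) (cong suc (φ′≗ r)))
              , λ { zero → ψ0≡0 ; (suc s) → trans (ψ≗ s) (cong suc (ψ′≗ s)) })

-- Pigeonhole: punching out a missed value would inject `Fin (suc N)` into `Fin N`.
injective⇒noGap : (f : Fin N → Fin N) → Injective _≡_ _≡_ f → ∀ x → ¬ (∀ i → f i ≢ x)
injective⇒noGap {suc N} f inj x f≢x = ℕ.1+n≰n (Fin.injective⇒≤ {f = g} g-injective)
  where
  g : Fin (suc N) → Fin N
  g i = punchOut (f≢x i ∘ sym)

  g-injective : Injective _≡_ _≡_ g
  g-injective {i} {j} = inj ∘ Fin.punchOut-injective (f≢x i ∘ sym) (f≢x j ∘ sym)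

-- If φ r ≡ ψ s, choosing a preimage for each position would inject m + n
-- positions into Fin m ⊎ Fin n while missing r or s.
InJ⇒disjoint : {φ : Fin m → Fin (m + n)} {ψ : Fin n → Fin (m + n)} → InJ m n φ ψ → ∀ r s → φ r ≢ ψ s
InJ⇒disjoint {m} {n} {φ} {ψ} φψ r s φr≡ψs = absurd (source (φ r)) refl
  where
  open InJ φψ

  source : Fin (m + n) → Fin m ⊎ Fin n
  source i = [ inj₁ ∘ proj₁ , inj₂ ∘ proj₁ ]′ (cover i)

  target : Fin m ⊎ Fin n → Fin (m + n)
  target = [ φ , ψ ]′

  target∘source : ∀ i → target (source i) ≡ i
  target∘source i with cover i
  ... | inj₁ (_ , eq) = eq
  ... | inj₂ (_ , eq) = eq

  join-injective : ∀ {x y} → join m n x ≡ join m n y → x ≡ y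
  join-injective {x} {y} eq =
    trans (sym (Fin.splitAt-join m n x)) (trans (cong (splitAt m) eq) (Fin.splitAt-join m n y))

  source-onto : ∀ x → ¬ (∀ i → source i ≢ x)
  source-onto x gap = injective⇒noGap (join m n ∘ source)
    (λ {i} {j} eq → trans (sym (target∘source i))
      (trans (cong target (join-injective {source i} {source j} eq)) (target∘source j)))
    (join m n x) (λ i → gap i ∘ join-injective {source i} {x})

  source-target : ∀ {i x} → source i ≡ x → i ≡ target x
  source-target {i} eq = trans (sym (target∘source i)) (cong target eq)

  inj₁≢inj₂ : ∀ {r′ s′} → _≢_ {A = Fin m ⊎ Fin n} (inj₁ r′) (inj₂ s′)
  inj₁≢inj₂ ()

  absurd : ∀ x → source (φ r) ≢ x
  absurd (inj₁ _) eq = source-onto (inj₂ s) λ i source≡ → inj₁≢inj₂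
    (trans (sym eq) (trans (cong source (trans φr≡ψs (sym (source-target source≡)))) source≡))
  absurd (inj₂ _) eq = source-onto (inj₁ r) λ i source≡ → inj₁≢inj₂
    (trans (sym source≡) (trans (cong source (source-target source≡)) eq))

J⇒partition : (σ : J m n) → Partition (J.φ σ) (J.ψ σ)
J⇒partition σ = record
  { φ-<      = mono-≤∧injective⇒mono-< φ φ-mono φ-inj
  ; ψ-<      = mono-≤∧injective⇒mono-< ψ ψ-mono ψ-inj
  ; cover    = cover
  ; disjoint = InJ⇒disjoint inJ
  }
  where open J σ

toPath : J m n → Path m n (m + n)
toPath σ = proj₁ (partition⇒path _ _ (J⇒partition σ))

toPath-traces : (σ : J m n) → Traces (toPath σ) (J.φ σ) (J.ψ σ)
toPath-traces σ = proj₂ (partition⇒path _ _ (J⇒partition σ))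

-- Enumerations of paths and of `J`.

-- Left steps come before right steps, as in `shuffles`, which makes `spell-paths` an equality of
-- lists and not just a permutation.
paths : ∀ m n N → List (Path m n N)
paths zero    zero    zero    = [ done ]
paths zero    (suc n) zero    = []
paths (suc m) n       zero    = []
paths zero    zero    (suc N) = []
paths (suc m) zero    (suc N) = map left (paths m zero N)
paths zero    (suc n) (suc N) = map right (paths zero n N)
paths (suc m) (suc n) (suc N) = map left (paths m (suc n) N) ++ map right (paths (suc m) n N)

∈-paths : (c : Path m n N) → c ∈ paths m n N
∈-paths done                       = here refl
∈-paths {suc m} {zero}  (left c)   = ∈-map⁺ left (∈-paths c)
∈-paths {suc m} {suc n} (left c)   = ∈-++⁺ˡ (∈-map⁺ left (∈-paths c))
∈-paths {zero}  {suc n} (right c)  = ∈-map⁺ right (∈-paths c)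
∈-paths {suc m} {suc n} (right c)  = ∈-++⁺ʳ _ (∈-map⁺ right (∈-paths c))

left-injective : {c d : Path m n N} → left c ≡ left d → c ≡ d
left-injective refl = refl

right-injective : {c d : Path m n N} → right c ≡ right d → c ≡ d
right-injective refl = refl

paths-unique : ∀ m n N → Unique (paths m n N)
paths-unique zero    zero    zero    = [] ∷ []
paths-unique zero    (suc n) zero    = []
paths-unique (suc m) n       zero    = []
paths-unique zero    zero    (suc N) = []
paths-unique (suc m) zero    (suc N) = Unique.map⁺ left-injective (paths-unique m zero N)
paths-unique zero    (suc n) (suc N) = Unique.map⁺ right-injective (paths-unique zero n N)
paths-unique (suc m) (suc n) (suc N) = Unique.++⁺
  (Unique.map⁺ left-injective (paths-unique m (suc n) N))
  (Unique.map⁺ right-injective (paths-unique (suc m) n N))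
  left#right
  where
  left#right : ∀ {c} → ¬ (c ∈ map left (paths m (suc n) N) × c ∈ map right (paths (suc m) n N))
  left#right (∈l , ∈r) with ∈-map⁻ left ∈l | ∈-map⁻ right ∈r
  ... | _ , _ , refl | _ , _ , ()

funToFin-cong : {f g : Fin m → Fin n} → f ≗ g → funToFin f ≡ funToFin g
funToFin-cong {zero}  f≗g = refl
funToFin-cong {suc m} f≗g = cong₂ Fin.combine (f≗g zero) (funToFin-cong (f≗g ∘ suc))

finToFun-injective : {i j : Fin (n ^ m)} → finToFun {n} {m} i ≗ finToFun j → i ≡ j
finToFun-injective {n} {m} {i} {j} eq = trans (sym (Fin.funToFin-finToFin {m} {n} i))
  (trans (funToFin-cong {m} {n} eq) (Fin.funToFin-finToFin {m} {n} j))

-- Distinct codes differ at some argument after decoding, since `funToFin` recovers the code from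
-- the values alone.
allMaps-unique : ∀ m N → AllPairs (λ f g → ¬ (f ≗ g)) (allMaps m N)
allMaps-unique m N = AllPairs.map⁺
  (AllPairs.map (λ i≢j → i≢j ∘ finToFun-injective {N} {m}) (Unique.allFin⁺ (N ^ m)))

mapMaybe-allPairs : ∀ {ℓ₁ ℓ₂} {R : Rel A ℓ₁} {S : Rel B ℓ₂} (f : A → Maybe B) →
                    (∀ {x y u v} → R x y → f x ≡ just u → f y ≡ just v → S u v) →
                    ∀ {xs} → AllPairs R xs → AllPairs S (mapMaybe f xs)
mapMaybe-allPairs {R = R} {S = S} f R⇒S []                       = []
mapMaybe-allPairs {R = R} {S = S} f R⇒S (_∷_ {x} {xs} Rx Rxs) with f x in fx
... | nothing = mapMaybe-allPairs f R⇒S Rxs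
... | just u  = all Rx ∷ mapMaybe-allPairs f R⇒S Rxs
  where
  all : ∀ {ys} → All (R x) ys → All (S u) (mapMaybe f ys)
  all []                 = []
  all (_∷_ {y} Rxy Rxys) with f y in fy
  ... | nothing = all Rxys
  ... | just v  = R⇒S Rxy fx fy ∷ all Rxys

-- Elements of `J` are compared by the values of their maps only; the proofs in them are ignored.
Same : Rel (J m n) _
Same σ τ = (J.φ σ ≗ J.φ τ) × (J.ψ σ ≗ J.ψ τ)

allJ-unique : ∀ m n → AllPairs (λ σ τ → ¬ Same σ τ) (allJ m n)
allJ-unique m n = mapMaybe-allPairs _
  (λ {x} {y} x≉y fx fy (φ≗ , ψ≗) →
    let φ≡ , ψ≡ = map-mkJ (dec⇒maybe (inJ? (proj₁ x) (proj₂ x))) fx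
        φ≡′ , ψ≡′ = map-mkJ (dec⇒maybe (inJ? (proj₁ y) (proj₂ y))) fy
    in x≉y (subst₂ _≗_ φ≡ φ≡′ φ≗ , subst₂ _≗_ ψ≡ ψ≡′ ψ≗))
  (UniqueS.cartesianProduct⁺ (Fin m →-setoid Fin (m + n)) (Fin n →-setoid Fin (m + n))
    (allMaps-unique m (m + n)) (allMaps-unique n (m + n)))
  where
  map-mkJ : ∀ {φ ψ σ} (p : Maybe (InJ m n φ ψ)) →
            Maybe.map (mkJ φ ψ) p ≡ just σ → J.φ σ ≡ φ × J.ψ σ ≡ ψ
  map-mkJ (just _) refl = refl , refl

-- Encoding and decoding the position maps of `c` gives a listed candidate, and `traces⇒InJ` rules
-- out its rejection by `inJ?`. The listed maps agree with those of `c` pointwise, hence the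
-- formulation by `Traces`.
allJ-complete : (c : Path m n (m + n)) → Any (λ σ → Traces c (J.φ σ) (J.ψ σ)) (allJ m n)
allJ-complete {m} {n} c = Any.mapMaybe⁺ _ _ (Any.map⁺ (lose
  (∈-cartesianProduct⁺ (∈-map⁺ finToFun (∈-allFin (funToFin (leftPos c))))
                       (∈-map⁺ finToFun (∈-allFin (funToFin (rightPos c)))))
  (found _ _ traces)))
  where
  traces : Traces c (finToFun {m + n} {m} (funToFin (leftPos c)))
                    (finToFun {m + n} {n} (funToFin (rightPos c)))
  traces = Fin.finToFun-funToFin (leftPos c) , Fin.finToFun-funToFin (rightPos c)

  found : ∀ φ ψ → Traces c φ ψ → MAny.Any (λ σ → Traces c (J.φ σ) (J.ψ σ))
                                   (Maybe.map (mkJ φ ψ) (dec⇒maybe (inJ? φ ψ)))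
  found φ ψ t with inJ? φ ψ
  ... | yes _   = MAny.just t
  ... | no ¬inJ = contradiction (traces⇒InJ t) ¬inJ

-- Both lists are free of repetitions and contain every path. The left one has no repetitions
-- because a path determines the values of both maps.
toPath-allJ : ∀ m n → map toPath (allJ m n) ↭ paths m n (m + n)
toPath-allJ m n = ∼bag⇒↭ (unique∧set⇒bag unique (paths-unique m n (m + n))
  λ {c} → mk⇔ (λ _ → ∈-paths c) (λ _ → complete c))
  where
  toPath-≡⇒Same : ∀ (σ τ : J m n) → toPath σ ≡ toPath τ → Same σ τ
  toPath-≡⇒Same σ τ eq =
      (λ r → trans (S.φ≗ r) (trans (cong (λ c → leftPos c r) eq) (sym (T.φ≗ r))))
    , (λ s → trans (S.ψ≗ s) (trans (cong (λ c → rightPos c s) eq) (sym (T.ψ≗ s))))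
    where
    module S = Traces (toPath-traces σ)
    module T = Traces (toPath-traces τ)

  unique : Unique (map toPath (allJ m n))
  unique = AllPairs.map⁺ (AllPairs.map (λ {σ} {τ} ≉ → ≉ ∘ toPath-≡⇒Same σ τ) (allJ-unique m n))

  complete : ∀ c → c ∈ map toPath (allJ m n)
  complete c = Any.map⁺ (Any.map
    (λ {σ} (φ≗ , ψ≗) → let module S = Traces (toPath-traces σ) in
      positions-injective c (toPath σ)
        (λ r → trans (sym (φ≗ r)) (S.φ≗ r)) (λ s → trans (sym (ψ≗ s)) (S.ψ≗ s)))
    (allJ-complete c))

-- Words spelled by paths and the recursive shuffle.

-- The letter at a position is chosen by `cover`; the path has the same index at that position, so
-- it reads the same letter.
shuffled-spell : (u v : Word X) (σ : J (length u) (length v)) →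
                 shuffled u v σ ≡ spell (toPath σ) (lookup u) (lookup v)
shuffled-spell {X = X} u v σ = List.tabulate-cong letter≗
  where
  open Traces (toPath-traces σ)

  -- Recovers from the type of refl the function tabulated by shuffled, which
  -- is local to Defs and cannot be named.
  generator : ∀ {N} {f : Fin N → X} {w} → w ≡ tabulate f → Fin N → X
  generator {f = f} _ = f

  letter : Fin (length u + length v) → X
  letter = letterAt (toPath σ) (lookup u) (lookup v)

  letter≗ : generator {w = shuffled u v σ} refl ≗ letter
  letter≗ i with J.cover σ i
  ... | inj₁ (r , refl) = sym (trans (cong letter (φ≗ r)) (letterAt-leftPos (toPath σ) _ _ r))
  ... | inj₂ (s , refl) = sym (trans (cong letter (ψ≗ s)) (letterAt-rightPos (toPath σ) _ _ s))

shuffles : Word X → Word X → List (Word X)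
shuffles []      v       = [ v ]
shuffles (x ∷ u) []      = [ x ∷ u ]
shuffles (x ∷ u) (y ∷ v) = map (x ∷_) (shuffles u (y ∷ v)) ++ map (y ∷_) (shuffles (x ∷ u) v)

shuffles-[] : (u : Word X) → shuffles u [] ≡ [ u ]
shuffles-[] []      = refl
shuffles-[] (x ∷ u) = refl

-- `spell` of a `left` step computes to `x` followed by the word of the remaining path, so only
-- fusion of maps is left.
map-spell-left : (x : X) (u v : Word X) (cs : List (Path (length u) (length v) N)) →
                 map (λ c → spell c (lookup (x ∷ u)) (lookup v)) (map left cs) ≡
                 map (x ∷_) (map (λ c → spell c (lookup u) (lookup v)) cs)
map-spell-left x u v cs = trans (sym (List.map-∘ cs)) (List.map-∘ cs)

map-spell-right : (y : X) (u v : Word X) (cs : List (Path (length u) (length v) N)) →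
                  map (λ c → spell c (lookup u) (lookup (y ∷ v))) (map right cs) ≡
                  map (y ∷_) (map (λ c → spell c (lookup u) (lookup v)) cs)
map-spell-right y u v cs = trans (sym (List.map-∘ cs)) (List.map-∘ cs)

spell-paths : (u v : Word X) → N ≡ length u + length v →
              map (λ c → spell c (lookup u) (lookup v)) (paths (length u) (length v) N) ≡ shuffles u v
spell-paths []      []      refl = refl
spell-paths []      (y ∷ v) refl =
  trans (map-spell-right y [] v _) (cong (map (y ∷_)) (spell-paths [] v refl))
spell-paths (x ∷ u) []      refl =
  trans (map-spell-left x u [] _) (cong (map (x ∷_)) (trans (spell-paths u [] refl) (shuffles-[] u)))
spell-paths (x ∷ u) (y ∷ v) refl =
  trans (List.map-++ _ (map left lefts) (map right rights)) (cong₂ _++_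
    (trans (map-spell-left x u (y ∷ v) lefts) (cong (map (x ∷_)) (spell-paths u (y ∷ v) refl)))
    (trans (map-spell-right y (x ∷ u) v rights)
      -- The right branch has `length u + suc (length v)` steps, which is
      -- `suc (length u) + length v` only by a proof; this is why `N` enters through an equation.
      (cong (map (y ∷_)) (spell-paths (x ∷ u) v (ℕ.+-suc (length u) (length v))))))
  where
  lefts  = paths (length u) (suc (length v)) (length u + suc (length v))
  rights = paths (suc (length u)) (length v) (length u + suc (length v))

-- Concatenated lists up to permutation.

concatMap-↭ : (f : A → List B) {xs ys : List A} → xs ↭ ys → concatMap f xs ↭ concatMap f ys
concatMap-↭ f refl                = ↭-refl
concatMap-↭ f (prep x xs↭ys)      = ↭.++⁺ˡ (f x) (concatMap-↭ f xs↭ys)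
concatMap-↭ f (swap x y xs↭ys)    = ↭-trans (↭.shifts (f x) (f y))
  (↭.++⁺ˡ (f y) (↭.++⁺ˡ (f x) (concatMap-↭ f xs↭ys)))
concatMap-↭ f (↭.trans xs↭ys ys↭zs) = ↭-trans (concatMap-↭ f xs↭ys) (concatMap-↭ f ys↭zs)

concatMap-cong-↭ : {f g : A → List B} → (∀ x → f x ↭ g x) → ∀ xs → concatMap f xs ↭ concatMap g xs
concatMap-cong-↭ f↭g []       = ↭-refl
concatMap-cong-↭ f↭g (x ∷ xs) = ↭.++⁺ (f↭g x) (concatMap-cong-↭ f↭g xs)

concatMap-++-↭ : (f g : A → List B) → ∀ xs →
                 concatMap (λ x → f x ++ g x) xs ↭ concatMap f xs ++ concatMap g xs
concatMap-++-↭ f g []       = ↭-refl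
concatMap-++-↭ f g (x ∷ xs) = begin
  (f x ++ g x) ++ concatMap (λ x → f x ++ g x) xs
    ↭⟨ ↭.++⁺ˡ (f x ++ g x) (concatMap-++-↭ f g xs) ⟩
  (f x ++ g x) ++ (concatMap f xs ++ concatMap g xs)
    ≡⟨ List.++-assoc (f x) (g x) _ ⟩
  f x ++ g x ++ concatMap f xs ++ concatMap g xs
    ↭⟨ ↭.++⁺ˡ (f x) (↭.shifts (g x) (concatMap f xs)) ⟩
  f x ++ concatMap f xs ++ g x ++ concatMap g xs
    ≡⟨ List.++-assoc (f x) (concatMap f xs) _ ⟨
  (f x ++ concatMap f xs) ++ g x ++ concatMap g xs ∎
  where open PermutationReasoning

concatMap-concatMap : (f : B → List C) (g : A → List B) →
                      concatMap f ∘ concatMap g ≗ concatMap (concatMap f ∘ g)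
concatMap-concatMap f g []       = refl
concatMap-concatMap f g (x ∷ xs) =
  trans (List.concatMap-++ f (g x) (concatMap g xs))
    (cong (concatMap f (g x) ++_) (concatMap-concatMap f g xs))

-- Cutting a shuffle at a marked letter.

-- The bracketing is that of the product `_·_`, which associates to the left.
glue : X → List (Word X) → List (Word X) → List (Word X)
glue x = cartesianProductWith (λ u v → (u ++ [ x ]) ++ v)

glue-map-∷ : (x y : X) (us vs : List (Word X)) →
             glue x (map (y ∷_) us) vs ≡ map (y ∷_) (glue x us vs)
glue-map-∷ x y []       vs = refl
glue-map-∷ x y (u ∷ us) vs = trans (cong₂ _++_ (List.map-∘ vs) (glue-map-∷ x y us vs))
  (sym (List.map-++ (y ∷_) (map ((u ++ [ x ]) ++_) vs) (glue x us vs)))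

-- Factorisations with a nonempty first factor, kept apart from the one with an empty first factor
-- because the latter yields the separate last summand.
splits⁺ : List A → List (List A × List A)
splits⁺ []      = []
splits⁺ (x ∷ v) = map (map₁ (x ∷_)) (([] , v) ∷ splits⁺ v)

splits : List A → List (List A × List A)
splits v = ([] , v) ∷ splits⁺ v

module _ (x : X) (u′ : Word X) where

  -- These are the shuffles of `u ++ x ∷ u′` with `v₁ ++ v₂` in which exactly the letters of `v₁`
  -- from the second word precede the marked `x`.
  through : Word X → Word X × Word X → List (Word X)
  through u (v₁ , v₂) = glue x (shuffles u v₁) (shuffles u′ v₂)

  through-[]-∷ : (y : X) (p : Word X × Word X) →
                 through [] (map₁ (y ∷_) p) ≡ map (y ∷_) (through [] p)
  through-[]-∷ y (v₁ , v₂) = glue-map-∷ x y [ v₁ ] (shuffles u′ v₂)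

  through-∷-[] : (t : X) (u v : Word X) → through (t ∷ u) ([] , v) ≡ map (t ∷_) (through u ([] , v))
  through-∷-[] t u v rewrite shuffles-[] u = glue-map-∷ x t [ u ] (shuffles u′ v)

  -- The recursion of `shuffles` acts on the part left of the marked letter, and `glue` distributes
  -- over its two branches.
  through-∷-∷ : (t y : X) (u : Word X) (p : Word X × Word X) →
                through (t ∷ u) (map₁ (y ∷_) p) ≡
                map (t ∷_) (through u (map₁ (y ∷_) p)) ++ map (y ∷_) (through (t ∷ u) p)
  through-∷-∷ t y u (v₁ , v₂) = trans
    (List.cartesianProductWith-distribʳ-++ _ (map (t ∷_) (shuffles u (y ∷ v₁)))
      (map (y ∷_) (shuffles (t ∷ u) v₁)) (shuffles u′ v₂))
    (cong₂ _++_ (glue-map-∷ x t (shuffles u (y ∷ v₁)) (shuffles u′ v₂))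
      (glue-map-∷ x y (shuffles (t ∷ u) v₁) (shuffles u′ v₂)))

  -- Induction along the recursion of `shuffles`. The words are sorted by their first letter on one
  -- side and by the factorisation of `v` on the other, so the two groupings agree up to
  -- permutation.
  shuffles-split : (u v : Word X) → shuffles (u ++ x ∷ u′) v ↭ concatMap (through u) (splits v)
  shuffles-split []      []      rewrite shuffles-[] u′ = ↭-refl
  shuffles-split (t ∷ u) []      rewrite shuffles-[] u′ =
    ↭-reflexive (cong (λ w → [ t ∷ w ]) (sym (List.++-assoc u [ x ] u′)))
  shuffles-split []      (y ∷ v) = begin
    map (x ∷_) (shuffles u′ (y ∷ v)) ++ map (y ∷_) (shuffles (x ∷ u′) v)
      ↭⟨ ↭.++⁺ˡ _ (↭.map⁺ (y ∷_) (shuffles-split [] v)) ⟩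
    map (x ∷_) (shuffles u′ (y ∷ v)) ++ map (y ∷_) (concatMap (through []) (splits v))
      -- Words starting with the marked `x` belong to the empty prefix; those starting with `y`
      -- extend a prefix of `v` by `y`.
      ≡⟨ cong₂ _++_ (List.++-identityʳ _) step ⟨
    through [] ([] , y ∷ v) ++ concatMap (through []) (map (map₁ (y ∷_)) (splits v)) ∎
    where
    open PermutationReasoning
    step : concatMap (through []) (map (map₁ (y ∷_)) (splits v)) ≡
           map (y ∷_) (concatMap (through []) (splits v))
    step = trans (List.concatMap-map (through []) (map₁ (y ∷_)) (splits v))
      (trans (List.concatMap-cong (through-[]-∷ y) (splits v))
        (sym (List.map-concatMap (y ∷_) (through []) (splits v))))
  shuffles-split (t ∷ u) (y ∷ v) = begin
    map (t ∷_) (shuffles (u ++ x ∷ u′) (y ∷ v)) ++ map (y ∷_) (shuffles (t ∷ u ++ x ∷ u′) v)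
      ↭⟨ ↭.++⁺ (↭.map⁺ (t ∷_) (shuffles-split u (y ∷ v))) (↭.map⁺ (y ∷_) (shuffles-split (t ∷ u) v)) ⟩
    map (t ∷_) (through u ([] , y ∷ v) ++ concatMap (through u) S) ++ Y
      ≡⟨ cong (_++ Y) (List.map-++ (t ∷_) (through u ([] , y ∷ v)) _) ⟩
    (map (t ∷_) (through u ([] , y ∷ v)) ++ map (t ∷_) (concatMap (through u) S)) ++ Y
      ≡⟨ List.++-assoc (map (t ∷_) (through u ([] , y ∷ v))) _ Y ⟩
    map (t ∷_) (through u ([] , y ∷ v)) ++ map (t ∷_) (concatMap (through u) S) ++ Y
      -- The empty prefix occurs only in the branch of `t`, since no letter of the second word may
      -- then precede `x`; all other prefixes collect words from both branches.
      ↭⟨ ↭.++⁺ (↭-reflexive (sym (through-∷-[] t u (y ∷ v)))) step ⟩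
    through (t ∷ u) ([] , y ∷ v) ++ concatMap (through (t ∷ u)) S ∎
    where
    open PermutationReasoning
    S = map (map₁ (y ∷_)) (splits v)
    Y = map (y ∷_) (concatMap (through (t ∷ u)) (splits v))
    step : map (t ∷_) (concatMap (through u) S) ++ Y ↭ concatMap (through (t ∷ u)) S
    step = begin
      map (t ∷_) (concatMap (through u) S) ++ Y
        ≡⟨ cong₂ _++_
             (trans (List.map-concatMap (t ∷_) (through u) S)
               (List.concatMap-map (map (t ∷_) ∘ through u) (map₁ (y ∷_)) (splits v)))
             (List.map-concatMap (y ∷_) (through (t ∷ u)) (splits v)) ⟩
      concatMap (λ p → map (t ∷_) (through u (map₁ (y ∷_) p))) (splits v) ++
        concatMap (λ p → map (y ∷_) (through (t ∷ u) p)) (splits v)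
        ↭⟨ concatMap-++-↭ (λ p → map (t ∷_) (through u (map₁ (y ∷_) p)))
             (map (y ∷_) ∘ through (t ∷ u)) (splits v) ⟨
      concatMap (λ p → map (t ∷_) (through u (map₁ (y ∷_) p)) ++ map (y ∷_) (through (t ∷ u) p))
        (splits v)
        ≡⟨ List.concatMap-cong (through-∷-∷ t y u) (splits v) ⟨
      concatMap (through (t ∷ u) ∘ map₁ (y ∷_)) (splits v)
        ≡⟨ List.concatMap-map (through (t ∷ u)) (map₁ (y ∷_)) (splits v) ⟨
      concatMap (through (t ∷ u)) S ∎

-- Factorisations of a product of powers.

-- A nonempty prefix either ends within `u` or consists of `u` and a nonempty prefix of `v`.
-- Demanding nonemptiness counts the cut between `u` and `v` once.
splits⁺-++ : (u v : List A) →
             splits⁺ (u ++ v) ≡ map (map₂ (_++ v)) (splits⁺ u) ++ map (map₁ (u ++_)) (splits⁺ v)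
splits⁺-++ []      v = sym (List.map-id (splits⁺ v))
splits⁺-++ (x ∷ u) v = cong (([ x ] , u ++ v) ∷_) (begin
  map (map₁ (x ∷_)) (splits⁺ (u ++ v))
    ≡⟨ cong (map (map₁ (x ∷_))) (splits⁺-++ u v) ⟩
  map (map₁ (x ∷_)) (map (map₂ (_++ v)) (splits⁺ u) ++ map (map₁ (u ++_)) (splits⁺ v))
    ≡⟨ List.map-++ (map₁ (x ∷_)) (map (map₂ (_++ v)) (splits⁺ u)) _ ⟩
  map (map₁ (x ∷_)) (map (map₂ (_++ v)) (splits⁺ u)) ++ map (map₁ (x ∷_)) (map (map₁ (u ++_)) (splits⁺ v))
    ≡⟨ cong₂ _++_ (trans (sym (List.map-∘ (splits⁺ u))) (List.map-∘ (splits⁺ u)))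
         (sym (List.map-∘ (splits⁺ v))) ⟩
  map (map₂ (_++ v)) (map (map₁ (x ∷_)) (splits⁺ u)) ++ map (map₁ ((x ∷ u) ++_)) (splits⁺ v) ∎)
  where open ≡-Reasoning

splits⁺-^ʷ : (x : X) (n : ℕ) → splits⁺ (x ^ʷ n) ≡ map (λ p → x ^ʷ p , x ^ʷ (n ∸ p)) [1⋯ n ]
splits⁺-^ʷ x zero    = refl
splits⁺-^ʷ x (suc n) = cong (([ x ] , x ^ʷ n) ∷_) (begin
  map (map₁ (x ∷_)) (splits⁺ (x ^ʷ n))
    ≡⟨ cong (map (map₁ (x ∷_))) (splits⁺-^ʷ x n) ⟩
  map (map₁ (x ∷_)) (map (λ p → x ^ʷ p , x ^ʷ (n ∸ p)) [1⋯ n ])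
    -- Shifting `p` by one leaves the second factor unchanged, as `suc n ∸ suc p` computes to
    -- `n ∸ p`.
    ≡⟨ trans (sym (List.map-∘ [1⋯ n ])) (List.map-∘ [1⋯ n ]) ⟩
  map (λ p → x ^ʷ p , x ^ʷ (suc n ∸ p)) (map suc [1⋯ n ])
    ≡⟨ cong (map _) (List.map-tabulate {n = n} (λ i → ℕ.suc (toℕ i)) ℕ.suc) ⟩
  map (λ p → x ^ʷ p , x ^ʷ (suc n ∸ p)) (tabulate {n = n} (λ i → ℕ.suc (ℕ.suc (toℕ i)))) ∎)
  where open ≡-Reasoning

cut : ∀ {ℓ} → (Fin ℓ → X) → (Fin ℓ → ℕ) → Fin ℓ → ℕ → Word X × Word X
cut z n j p = powerWord< j z n ++ z j ^ʷ p , z j ^ʷ (n j ∸ p) ++ powerWord> j z n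

-- Each nonempty prefix ends at the `p`-th letter of exactly one block `j`. The induction separates
-- the first block, whose cuts have `j` equal to `zero`, from the later ones.
splits⁺-powerWord : ∀ {ℓ} (z : Fin ℓ → X) (n : Fin ℓ → ℕ) →
                    splits⁺ (powerWord z n) ≡ concatMap (λ j → map (cut z n j) [1⋯ n j ]) (allFin ℓ)
splits⁺-powerWord {ℓ = zero}  z n = refl
splits⁺-powerWord {ℓ = suc ℓ} z n = trans (splits⁺-++ z₁ V) (cong₂ _++_ first rest)
  where
  open ≡-Reasoning
  z₁ = z zero ^ʷ n zero
  V  = powerWord (z ∘ suc) (n ∘ suc)

  first : map (map₂ (_++ V)) (splits⁺ z₁) ≡ map (cut z n zero) [1⋯ n zero ]
  first = trans (cong (map (map₂ (_++ V))) (splits⁺-^ʷ (z zero) (n zero)))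
    (sym (List.map-∘ [1⋯ n zero ]))

  shift-cut : ∀ j p → map₁ (z₁ ++_) (cut (z ∘ suc) (n ∘ suc) j p) ≡ cut z n (suc j) p
  shift-cut j p = cong (_, z (suc j) ^ʷ (n (suc j) ∸ p) ++ powerWord> (suc j) z n)
    (sym (List.++-assoc z₁ (powerWord< j (z ∘ suc) (n ∘ suc)) _))

  rest : map (map₁ (z₁ ++_)) (splits⁺ V) ≡ concatMap (λ j → map (cut z n j) [1⋯ n j ]) (tabulate suc)
  rest = begin
    map (map₁ (z₁ ++_)) (splits⁺ V)
      ≡⟨ cong (map (map₁ (z₁ ++_))) (splits⁺-powerWord (z ∘ suc) (n ∘ suc)) ⟩
    map (map₁ (z₁ ++_)) (concatMap (λ j → map (cut (z ∘ suc) (n ∘ suc) j) [1⋯ n (suc j) ]) (allFin ℓ))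
      ≡⟨ List.map-concatMap (map₁ (z₁ ++_)) _ (allFin ℓ) ⟩
    concatMap (λ j → map (map₁ (z₁ ++_)) (map (cut (z ∘ suc) (n ∘ suc) j) [1⋯ n (suc j) ])) (allFin ℓ)
      ≡⟨ List.concatMap-cong
           (λ j → trans (sym (List.map-∘ [1⋯ n (suc j) ])) (List.map-cong (shift-cut j) [1⋯ n (suc j) ]))
           (allFin ℓ) ⟩
    concatMap (λ j → map (cut z n (suc j)) [1⋯ n (suc j) ]) (allFin ℓ)
      ≡⟨ List.concatMap-map (λ j → map (cut z n j) [1⋯ n j ]) suc (allFin ℓ) ⟨
    concatMap (λ j → map (cut z n j) [1⋯ n j ]) (map suc (allFin ℓ))
      ≡⟨ cong (concatMap λ j → map (cut z n j) [1⋯ n j ]) (List.map-tabulate {n = ℓ} id Fin.suc) ⟩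
    concatMap (λ j → map (cut z n j) [1⋯ n j ]) (tabulate suc) ∎

-- From lists of words to vectors with all coefficients 1.

vec : List (Word X) → ℚ⟨ X ⟩
vec = map (1ℚ ,_)

↭⇒≈ : {s t : ℚ⟨ X ⟩} → s ↭ t → s ≈ t
↭⇒≈ refl          = ≈-refl
↭⇒≈ (prep s p)    = ≈-cons s (↭⇒≈ p)
↭⇒≈ (swap s t p)  = ≈-trans (≈-swap s t) (≈-cons t (≈-cons s (↭⇒≈ p)))
↭⇒≈ (↭.trans p q) = ≈-trans (↭⇒≈ p) (↭⇒≈ q)

∑-vec : (is : List A) {f : A → ℚ⟨ X ⟩} {g : A → List (Word X)} →
        (∀ i → f i ↭ vec (g i)) → ∑ is f ↭ vec (concatMap g is)
∑-vec is {g = g} f↭g =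
  ↭-trans (concatMap-cong-↭ f↭g is) (↭-reflexive (sym (List.map-concatMap (1ℚ ,_) g is)))

-- For nonempty words the sum over `J` is reindexed by paths, which spell out the recursive shuffle.
shuffleWords-shuffles : (u v : Word X) → shuffleWords u v ↭ vec (shuffles u v)
shuffleWords-shuffles []        v         = ↭-refl
shuffleWords-shuffles (_ ∷ _)   []        = ↭-refl
shuffleWords-shuffles u@(_ ∷ _) v@(_ ∷ _) = begin
  concatMap (λ σ → ⟦ shuffled u v σ ⟧) Js
    ≡⟨ List.concatMap-map [_] (λ σ → 1ℚ , shuffled u v σ) Js ⟨
  concatMap [_] (map (λ σ → 1ℚ , shuffled u v σ) Js)
    ≡⟨ List.concatMap-pure _ ⟩
  map (λ σ → 1ℚ , shuffled u v σ) Js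
    ≡⟨ List.map-∘ Js ⟩
  vec (map (shuffled u v) Js)
    ≡⟨ cong vec (List.map-cong (shuffled-spell u v) Js) ⟩
  vec (map (spellUV ∘ toPath) Js)
    ≡⟨ cong vec (List.map-∘ Js) ⟩
  vec (map spellUV (map toPath Js))
    ↭⟨ ↭.map⁺ (1ℚ ,_) (↭.map⁺ spellUV (toPath-allJ (length u) (length v))) ⟩
  vec (map spellUV (paths (length u) (length v) (length u + length v)))
    ≡⟨ cong vec (spell-paths u v refl) ⟩
  vec (shuffles u v) ∎
  where
  open PermutationReasoning
  Js = allJ (length u) (length v)
  spellUV = λ (c : Path (length u) (length v) (length u + length v)) → spell c (lookup u) (lookup v)

-- The products of `1ℚ` are closed terms that evaluate to `1ℚ`, so the heads agree by computation.
⊙-vec : (ws : List (Word X)) → (1ℚ ℚ.* 1ℚ) ⊙ vec ws ≡ vec ws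
⊙-vec []       = refl
⊙-vec (w ∷ ws) = cong (_ ∷_) (⊙-vec ws)

⧢-vec : (u v : Word X) → ⟦ u ⟧ ⧢ ⟦ v ⟧ ↭ vec (shuffles u v)
⧢-vec u v = begin
  -- On two single words each of the two nested sums of `bilinear` leaves a trailing empty list.
  ((1ℚ ℚ.* 1ℚ) ⊙ shuffleWords u v ++ []) ++ []
    ≡⟨ trans (List.++-identityʳ _) (List.++-identityʳ _) ⟩
  (1ℚ ℚ.* 1ℚ) ⊙ shuffleWords u v
    ↭⟨ ↭.map⁺ _ (shuffleWords-shuffles u v) ⟩
  (1ℚ ℚ.* 1ℚ) ⊙ vec (shuffles u v)
    ≡⟨ ⊙-vec (shuffles u v) ⟩
  vec (shuffles u v) ∎
  where open PermutationReasoning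

bilinear-↭ : (f : Word X → Word X → ℚ⟨ X ⟩) {s s′ t t′ : ℚ⟨ X ⟩} →
             s ↭ s′ → t ↭ t′ → bilinear f s t ↭ bilinear f s′ t′
bilinear-↭ f {s} s↭s′ t↭t′ =
  ↭-trans (concatMap-cong-↭ (λ _ → concatMap-↭ _ t↭t′) s) (concatMap-↭ _ s↭s′)

vec-·-vec : (us vs : List (Word X)) → vec us · vec vs ≡ vec (cartesianProductWith _++_ us vs)
vec-·-vec []       vs = refl
vec-·-vec (u ∷ us) vs = trans (cong₂ _++_ (row vs) (vec-·-vec us vs))
  (sym (List.map-++ (1ℚ ,_) (map (u ++_) vs) _))
  where
  row : ∀ vs → ∑ (vec vs) (λ { (d , v) → (1ℚ ℚ.* d) ⊙ ⟦ u ++ v ⟧ }) ≡ vec (map (u ++_) vs)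
  row []       = refl
  row (v ∷ vs) = cong (_ ∷_) (row vs)

·-vec : {s t : ℚ⟨ X ⟩} {us vs : List (Word X)} →
        s ↭ vec us → t ↭ vec vs → s · t ↭ vec (cartesianProductWith _++_ us vs)
·-vec {us = us} {vs} s↭ t↭ =
  ↭-trans (bilinear-↭ (λ u v → ⟦ u ++ v ⟧) s↭ t↭) (↭-reflexive (vec-·-vec us vs))

cartesianProductWith-[] : ∀ {D E : Set a} (f : B → C → D) (g : A → E → B) (y : E) → ∀ xs zs →
  cartesianProductWith f (cartesianProductWith g xs [ y ]) zs ≡
  cartesianProductWith (λ x → f (g x y)) xs zs
cartesianProductWith-[] f g y []       zs = refl
cartesianProductWith-[] f g y (x ∷ xs) zs =
  cong (map (f (g x y)) zs ++_) (cartesianProductWith-[] f g y xs zs)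

-- The identity for a power followed by an arbitrary word.

-- This exhibits the last letter of the block `x ^ʷ suc m` as the marked letter of `shuffles-split`.
^ʷ-++-∷ : (x : X) (m : ℕ) (w : Word X) → x ^ʷ m ++ x ∷ w ≡ x ∷ x ^ʷ m ++ w
^ʷ-++-∷ x zero    w = refl
^ʷ-++-∷ x (suc m) w = cong (x ∷_) (^ʷ-++-∷ x m w)

-- Only the first block of the left word is cut, so the remaining blocks may be any word `w`.
power-⧢-powerWord : ∀ {ℓ} (x : X) (m : ℕ) (w : Word X) (z : Fin ℓ → X) (n : Fin ℓ → ℕ) →
  ⟦ x ^ʷ suc m ++ w ⟧ ⧢ ⟦ powerWord z n ⟧ ↭
    (∑[ j ∈ allFin ℓ ] ∑[ p ∈ [1⋯ n j ] ]
      ((⟦ x ^ʷ m ⟧ ⧢ ⟦ powerWord< j z n ++ z j ^ʷ p ⟧)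
        · ⟦ x ∷ [] ⟧
        · (⟦ w ⟧ ⧢ ⟦ z j ^ʷ (n j ∸ p) ++ powerWord> j z n ⟧)))
    ⊕ (⟦ x ^ʷ suc m ⟧ · (⟦ w ⟧ ⧢ ⟦ powerWord z n ⟧))
power-⧢-powerWord {ℓ = ℓ} x m w z n = begin
  ⟦ x ^ʷ suc m ++ w ⟧ ⧢ ⟦ Z ⟧
    ↭⟨ ⧢-vec (x ^ʷ suc m ++ w) Z ⟩
  vec (shuffles (x ^ʷ suc m ++ w) Z)
    ≡⟨ cong (λ u → vec (shuffles u Z)) (^ʷ-++-∷ x m w) ⟨
  vec (shuffles (x ^ʷ m ++ x ∷ w) Z)
    ↭⟨ ↭.map⁺ (1ℚ ,_) (shuffles-split x w (x ^ʷ m) Z) ⟩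
  vec (F ([] , Z) ++ concatMap F (splits⁺ Z))
    -- The empty prefix heads `splits`, whereas its summand comes last in the formula.
    ↭⟨ ↭.map⁺ (1ℚ ,_) (↭.++-comm (F ([] , Z)) _) ⟩
  vec (concatMap F (splits⁺ Z) ++ F ([] , Z))
    ≡⟨ List.map-++ (1ℚ ,_) (concatMap F (splits⁺ Z)) _ ⟩
  vec (concatMap F (splits⁺ Z)) ++ vec (F ([] , Z))
    ≡⟨ cong₂ (λ us vs → vec us ++ vec vs) cuts uncut ⟩
  vec (concatMap (λ j → concatMap (F ∘ cut z n j) [1⋯ n j ]) (allFin ℓ))
    ++ vec (cartesianProductWith _++_ [ x ^ʷ suc m ] (shuffles w Z))
    ↭⟨ ↭.++⁺ (∑-vec (allFin ℓ) λ j → ∑-vec [1⋯ n j ] λ p → term (cut z n j p))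
             (·-vec {us = [ x ^ʷ suc m ]} ↭-refl (⧢-vec w Z)) ⟨
  _ ∎
  where
  open PermutationReasoning
  Z = powerWord z n
  F = through x w (x ^ʷ m)

  cuts : concatMap F (splits⁺ Z) ≡ concatMap (λ j → concatMap (F ∘ cut z n j) [1⋯ n j ]) (allFin ℓ)
  cuts = trans (cong (concatMap F) (splits⁺-powerWord z n))
    (trans (concatMap-concatMap F _ (allFin ℓ))
      (List.concatMap-cong (λ j → List.concatMap-map F (cut z n j) [1⋯ n j ]) (allFin ℓ)))

  uncut : F ([] , Z) ≡ cartesianProductWith _++_ [ x ^ʷ suc m ] (shuffles w Z)
  -- With an empty prefix the left part is the single word `x ^ʷ m`, and appending the marked `x`
  -- gives `x ^ʷ suc m`.
  uncut rewrite shuffles-[] (x ^ʷ m) | ^ʷ-++-∷ x m [] | List.++-identityʳ (x ^ʷ m) = refl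

  term : ∀ ((v₁ , v₂) : Word _ × Word _) →
         (⟦ x ^ʷ m ⟧ ⧢ ⟦ v₁ ⟧) · ⟦ x ∷ [] ⟧ · (⟦ w ⟧ ⧢ ⟦ v₂ ⟧) ↭ vec (F (v₁ , v₂))
  term (v₁ , v₂) = ↭-trans (·-vec (·-vec {vs = [ [ x ] ]} (⧢-vec (x ^ʷ m) v₁) ↭-refl) (⧢-vec w v₂))
    (↭-reflexive (cong vec (cartesianProductWith-[] _++_ _++_ [ x ]
      (shuffles (x ^ʷ m) v₁) (shuffles w v₂))))

theorem2p2 : ∀ {a} {X : Set a} → X →
    (k ℓ : ℕ) →
    (y : Fin (suc k) → X) (z : Fin (suc ℓ) → X) →
    (m : Fin (suc k) → ℕ) (n : Fin (suc ℓ) → ℕ) →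
    (∀ i → 1 ≤ m i) → (∀ j → 1 ≤ n j) →
    let y₁ = y zero
        m₁ = m zero
        y₂⋯ = ⟦ powerWord (y ∘ suc) (m ∘ suc) ⟧
    in
    ⟦ powerWord y m ⟧ ⧢ ⟦ powerWord z n ⟧
      ≈ (∑[ j ∈ allFin (suc ℓ) ] ∑[ p ∈ [1⋯ n j ] ]
            ((⟦ y₁ ^ʷ (m₁ ∸ 1) ⟧ ⧢ ⟦ powerWord< j z n ++ z j ^ʷ p ⟧)
              · ⟦ y₁ ∷ [] ⟧
              · (y₂⋯ ⧢ ⟦ z j ^ʷ (n j ∸ p) ++ powerWord> j z n ⟧)))
        ⊕ (⟦ y₁ ^ʷ m₁ ⟧ · (y₂⋯ ⧢ ⟦ powerWord z n ⟧))
theorem2p2 _ k ℓ y z m n m≥1 _ with m zero | m≥1 zero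
-- Since `1 ≤ m zero`, the first exponent is a successor, and subtracting 1 from it computes to
-- `m₁`.
... | suc m₁ | _ = ↭⇒≈ (power-⧢-powerWord (y zero) m₁ (powerWord (y ∘ suc) (m ∘ suc)) z n)
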